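{- Let $M$ be an $n\times n$ primitive Boolean matrix with Boolean rank $b(M)=2$. Then $k(M)=2$ if and only if $M$ has a Boolean rank factorization $M=AB$ (with $A$ an $n\times 2$ and $B$ a $2\times n$ Boolean matrix) such that: (i) $BA=W_2$ or $BA=J_2$, where $W_2=\left[\begin{array}{cc}1&1\\1&0\end{array}\right]$ and $J_2=\left[\begin{array}{cc}1&1\\1&1\end{array}\right]$; (ii) some row of $A$ equals $e_1^t(2)$ and some row of $A$ equals $e_2^t(2)$; (iii) no column of $B$ equals $e_1(2)+e_2(2)$.
   Context: Boolean matrices are $(0,1)$-matrices with Boolean arithmetic ($1+1=1$). A square Boolean matrix is primitive if some power has all entries $1$; its scrambling index $k(M)$ is the smallest positive integer $k$ such that any two rows of $M^k$ have a $1$ in a common position (equivalently $M^k(M^t)^k=J$). The Boolean rank $b(M)$ is the smallest $b$ with $M=AB$, $A$ of size $n\times b$ and $B$ of size $b\times n$ Boolean; such a factorization is a Boolean rank factorization. $e_i(2)$ denotes the $i$th column of the $2\times 2$ identity matrix. -}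

module Defs where

open import Data.Bool.Base using (Bool; true; false; _∧_; _∨_)
open import Data.Bool.Properties using (∨-commutativeMonoid)
open import Data.Fin.Base using (Fin)
open import Data.Fin.Properties using (_≟_)
open import Data.Nat.Base using (ℕ; zero; suc; _≤_)
open import Data.Product.Base using (∃; ∃-syntax; _×_)
open import Data.Vec.Functional using (Vector; []; _∷_; zipWith; transpose)
open import Relation.Binary.PropositionalEquality.Core using (_≡_; _≗_)
open import Relation.Nullary.Decidable.Core using (does)
open import Algebra.Properties.CommutativeMonoid.Sum ∨-commutativeMonoid using (sum)

BoolMatrix : ℕ → ℕ → Set
BoolMatrix m n = Vector (Vector Bool n) m

infix 4 _≈_
infixl 7 _·_
infixr 8 _^_

_≈_ : ∀ {m n} → BoolMatrix m n → BoolMatrix m n → Set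
A ≈ B = ∀ i → A i ≗ B i

-- `sum` is the iterated Boolean sum _∨_.
_·_ : ∀ {m n p} → BoolMatrix m n → BoolMatrix n p → BoolMatrix m p
(A · B) i j = sum (λ k → A i k ∧ B k j)

identity : ∀ n → BoolMatrix n n
identity n i j = does (i ≟ j)

_^_ : ∀ {n} → BoolMatrix n n → ℕ → BoolMatrix n n
M ^ zero  = identity _
M ^ suc k = M · M ^ k

column : ∀ {m n} → BoolMatrix m n → Fin n → Vector Bool m
column A = transpose A

e : ∀ {n} → Fin n → Vector Bool n
e {n} = column (identity n)

_⊕_ : ∀ {n} → Vector Bool n → Vector Bool n → Vector Bool n
_⊕_ = zipWith _∨_

J : ∀ n → BoolMatrix n n
J n i j = true

W₂ : BoolMatrix 2 2
W₂ = (true ∷ true  ∷ [])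
   ∷ (true ∷ false ∷ [])
   ∷ []

IsSmallest : (ℕ → Set) → ℕ → Set
IsSmallest P k = P k × (∀ l → P l → k ≤ l)

-- The exponent must be positive, since M ^ 0 is the identity matrix.
Primitive : ∀ {n} → BoolMatrix n n → Set
Primitive {n} M = ∃[ k ] 1 ≤ k × M ^ k ≈ J n

-- Equivalent to N · transpose N ≈ J n; the rows i and j may coincide.
RowsIntersect : ∀ {n} → BoolMatrix n n → Set
RowsIntersect N = ∀ i j → ∃[ l ] N i l ≡ true × N j l ≡ true

-- k(M) = k.  Relational, as k(M) is not defined for every M.
IsScramblingIndex : ∀ {n} → BoolMatrix n n → ℕ → Set
IsScramblingIndex M = IsSmallest (λ k → 1 ≤ k × RowsIntersect (M ^ k))

-- b(M) = b.  The zero matrix has Boolean rank 0.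
IsBooleanRank : ∀ {m n} → BoolMatrix m n → ℕ → Set
IsBooleanRank {m} {n} M =
  IsSmallest (λ b → ∃ λ (A : BoolMatrix m b) → ∃ λ (B : BoolMatrix b n) → M ≈ A · B)

IsBooleanRankFactorization : ∀ {m n b} → BoolMatrix m n → BoolMatrix m b → BoolMatrix b n → Set
IsBooleanRankFactorization {b = b} M A B = IsBooleanRank M b × M ≈ A · B

{-# OPTIONS --safe #-}

-- Write M = AB and C = BA. If two rows i, j of M are disjoint, no nonzero row of B
-- lies in both, so A i and A j are the two unit vectors, and the two rows of B are
-- disjoint and nonzero. Restricting M ^ (m + 1) = J to rows e p of A and columns e q
-- of B shows C ^ m = J, which forces the 2 × 2 matrix C to be W₂ or J₂ up to
-- exchanging the two indices. Conversely, rows e p and e q of A turn the disjoint rows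
-- of B into disjoint rows of M, and the full first column of C makes every row of
-- M ^ 2 = ACB contain the first row of B.
module Submission where

open import Defs
open import Algebra.Properties.CommutativeMonoid.Sum using (sum)
open import Data.Bool.Base using (Bool; true; false; _∧_)
open import Data.Bool.Properties using (∨-commutativeMonoid; ∨-zeroʳ; ∨-assoc; ∨-comm; ¬-not) renaming (_≟_ to _≟ᵇ_)
open import Data.Empty using (⊥-elim)
open import Data.Fin.Base using (Fin; zero; suc; opposite)
open import Data.Fin.Patterns using (0F; 1F)
open import Data.Fin.Properties using (_≟_; any?; all?; ¬∀⟶∃¬; opposite-involutive; 0≢1+n)
open import Data.Nat.Base using (ℕ; zero; suc; _≤_; z≤n; s≤s)
open import Data.Nat.Properties using (1+n≰n)
open import Data.Product.Base using (∃; ∃-syntax; _×_; _,_; proj₁; proj₂)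
open import Data.Sum.Base using (_⊎_; inj₁; inj₂)
open import Function.Base using (_∘_)
open import Function.Bundles using (_⇔_; mk⇔)
open import Relation.Binary.PropositionalEquality.Core using (_≡_; _≗_; refl; sym; trans; cong; cong₂; subst)
open import Relation.Nullary.Decidable.Core using (Dec; yes; no; _×-dec_)
open import Relation.Nullary.Negation.Core using (¬_)

private
  variable
    m n b : ℕ

-- Boolean sums, products and the identity matrix

⋁ : (Fin n → Bool) → Bool
⋁ = sum ∨-commutativeMonoid

⋁-true⁻ : (f : Fin n → Bool) → ⋁ f ≡ true → ∃[ k ] f k ≡ true
⋁-true⁻ {suc n} f eq with f zero in f0
... | true  = zero , f0
... | false with ⋁-true⁻ (f ∘ suc) eq
...   | k , fk = suc k , fk

⋁-true⁺ : (f : Fin n → Bool) (k : Fin n) → f k ≡ true → ⋁ f ≡ true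
⋁-true⁺ f zero    fk rewrite fk = refl
⋁-true⁺ f (suc k) fk rewrite ⋁-true⁺ (f ∘ suc) k fk = ∨-zeroʳ (f zero)

∧-true⁻ : ∀ {x y} → x ∧ y ≡ true → x ≡ true × y ≡ true
∧-true⁻ {true} eq = refl , eq

·-true⁻ : (A : BoolMatrix m n) (B : BoolMatrix n b) {i : Fin m} {j : Fin b} →
          (A · B) i j ≡ true → ∃[ k ] A i k ≡ true × B k j ≡ true
·-true⁻ A B {i} {j} eq with ⋁-true⁻ (λ k → A i k ∧ B k j) eq
... | k , p = k , ∧-true⁻ p

·-true⁺ : (A : BoolMatrix m n) (B : BoolMatrix n b) {i : Fin m} {j : Fin b} (k : Fin n) →
          A i k ≡ true → B k j ≡ true → (A · B) i j ≡ true
·-true⁺ A B {i} {j} k p q = ⋁-true⁺ (λ k → A i k ∧ B k j) k (cong₂ _∧_ p q)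

identity-true⁻ : {i j : Fin n} → identity n i j ≡ true → i ≡ j
identity-true⁻ {i = i} {j} eq with i ≟ j
... | yes p = p

unit-row-support : {v : Fin n → Bool} {p k : Fin n} → v ≗ e p → v k ≡ true → k ≡ p
unit-row-support {p = p} {k} v≗ep vk = identity-true⁻ {i = k} {p} (trans (sym (v≗ep k)) vk)

identity-refl : (i : Fin n) → identity n i i ≡ true
identity-refl i with i ≟ i
... | yes _ = refl
... | no ¬p = ⊥-elim (¬p refl)

^1-true⁻ : (M : BoolMatrix n n) {i j : Fin n} → (M ^ 1) i j ≡ true → M i j ≡ true
^1-true⁻ M {i} p with ·-true⁻ M (identity _) p
... | _ , Mix , x≡j = subst (λ x → M i x ≡ true) (identity-true⁻ x≡j) Mix

^1-true⁺ : (M : BoolMatrix n n) {i j : Fin n} → M i j ≡ true → (M ^ 1) i j ≡ true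
^1-true⁺ M {j = j} p = ·-true⁺ M (identity _) j p (identity-refl j)

NonzeroRows : BoolMatrix m n → Set
NonzeroRows A = ∀ i → ∃[ j ] A i j ≡ true

AllUnitRows : BoolMatrix m n → Set
AllUnitRows A = ∀ p → ∃[ i ] A i ≗ e p

-- For a two-rowed `B` this is condition (iii): no column has both entries true.
DisjointRows : BoolMatrix m n → Set
DisjointRows B = ∀ p q j → B p j ≡ true → B q j ≡ true → p ≡ q

primitive⇒nonzeroRows : (M : BoolMatrix n n) → Primitive M → NonzeroRows M
primitive⇒nonzeroRows M (suc k , _ , M^k≈J) i with ·-true⁻ M (M ^ k) (M^k≈J i i)
... | x , Mix , _ = x , Mix

-- Powers and rows of `M` through a factorization

module Factored (M : BoolMatrix n n) (A : BoolMatrix n b) (B : BoolMatrix b n) (M≈AB : M ≈ A · B) where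

  factor⁻ : ∀ {i j} → M i j ≡ true → ∃[ k ] A i k ≡ true × B k j ≡ true
  factor⁻ {i} {j} p = ·-true⁻ A B (trans (sym (M≈AB i j)) p)

  factor⁺ : ∀ {i j} k → A i k ≡ true → B k j ≡ true → M i j ≡ true
  factor⁺ {i} {j} k p q = trans (M≈AB i j) (·-true⁺ A B k p q)

  -- Regrouping the factors turns (AB)(AB)...(AB) into A(BA)...(BA)B, so the core `B · A` occurs one
  -- time fewer than `M`.
  power-factor⁻ : ∀ k {i j} → (M ^ suc k) i j ≡ true →
                  ∃[ p ] ∃[ q ] A i p ≡ true × ((B · A) ^ k) p q ≡ true × B q j ≡ true
  power-factor⁻ zero p with factor⁻ (^1-true⁻ M p)
  ... | r , Air , Brj = r , r , Air , identity-refl r , Brj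
  power-factor⁻ (suc k) {j = j} p with ·-true⁻ M (M ^ suc k) {j = j} p
  ... | x , Mix , rest with factor⁻ Mix | power-factor⁻ k rest
  ...   | r , Air , Brx | s , q , Axs , Csq , Bqj =
    r , q , Air , ·-true⁺ (B · A) ((B · A) ^ k) s (·-true⁺ B A x Brx Axs) Csq , Bqj

  core-power : AllUnitRows A → NonzeroRows B → DisjointRows B →
               ∀ k → M ^ suc k ≈ J n → (B · A) ^ k ≈ J b
  core-power units nonzero disjoint k M^k≈J p q with units p | nonzero q
  ... | i , Ai≗ep | j , Bqj with power-factor⁻ k (M^k≈J i j)
  ...   | p′ , q′ , Aip′ , Cp′q′ , Bq′j
        with refl ← unit-row-support Ai≗ep Aip′
           | refl ← disjoint q q′ j Bqj Bq′j = Cp′q′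

  square-meets : (q : Fin b) → NonzeroRows M → (∀ p → (B · A) p q ≡ true) →
                 RowsIntersect (M ^ 2)
  square-meets q nonzero full i j with ·-true⁻ B A (full q)
  -- The diagonal entry `(B · A) q q` supplies `l` with `B q l` true; this one column serves every
  -- pair of rows.
  ... | l , Bql , _ = l , reach i , reach j
    where
    reach : ∀ i → (M ^ 2) i l ≡ true
    reach i with factor⁻ (proj₂ (nonzero i))
    ... | p , Aip , _ with ·-true⁻ B A (full p)
    ...   | x , Bpx , Axq =
      ·-true⁺ M (M ^ 1) x (factor⁺ p Aip Bpx) (^1-true⁺ M (factor⁺ q Axq Bql))

  -- A unit row `e p` of `A` makes the corresponding row of `M` equal to row `p` of `B`.
  unit-rows-disjoint : ∀ {i j p q} → A i ≗ e p → A j ≗ e q →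
                       (∀ l → B p l ≡ true → ¬ B q l ≡ true) → ¬ RowsIntersect (M ^ 1)
  unit-rows-disjoint {i} {j} Ai Aj disjoint meet with meet i j
  ... | l , Mil , Mjl with factor⁻ (^1-true⁻ M Mil) | factor⁻ (^1-true⁻ M Mjl)
  ...   | r , Air , Brl | s , Ajs , Bsl
        with refl ← unit-row-support Ai Air
           | refl ← unit-row-support Aj Ajs = disjoint l Brl Bsl

-- Meeting is decidable over finitely many indices, so a failing universal statement yields a
-- concrete pair.
disjoint-rows-exist : (M : BoolMatrix n n) → ¬ RowsIntersect (M ^ 1) →
                      ∃[ i ] ∃[ j ] ∀ l → M i l ≡ true → ¬ M j l ≡ true
disjoint-rows-exist {n} M ¬meet = i , j , λ l p q → ¬any (l , p , q)
  where
  Meet : Fin n → Fin n → Set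
  Meet i j = ∃[ l ] M i l ≡ true × M j l ≡ true

  meet? : ∀ i j → Dec (Meet i j)
  meet? i j = any? (λ l → (M i l ≟ᵇ true) ×-dec (M j l ≟ᵇ true))

  lift : (∀ i j → Meet i j) → RowsIntersect (M ^ 1)
  lift meet i j with meet i j
  ... | l , p , q = l , ^1-true⁺ M p , ^1-true⁺ M q

  witness : ∃[ i ] ∃[ j ] ¬ Meet i j
  witness with ¬∀⟶∃¬ n _ (λ i → all? (meet? i)) (¬meet ∘ lift)
  ... | i , ¬all = i , ¬∀⟶∃¬ n _ (meet? i) ¬all

  i = proj₁ witness
  j = proj₁ (proj₂ witness)
  ¬any = proj₂ (proj₂ witness)

-- Disjoint rows and inner dimension two

≡-or-opposite : (p q : Fin 2) → q ≡ p ⊎ q ≡ opposite p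
≡-or-opposite 0F 0F = inj₁ refl
≡-or-opposite 0F 1F = inj₂ refl
≡-or-opposite 1F 0F = inj₂ refl
≡-or-opposite 1F 1F = inj₁ refl

unit-vector : {v : Fin 2 → Bool} (p : Fin 2) → v p ≡ true → ¬ v (opposite p) ≡ true → v ≗ e p
unit-vector 0F p q 0F = p
unit-vector 0F p q 1F = ¬-not q
unit-vector 1F p q 0F = ¬-not q
unit-vector 1F p q 1F = p

swap-e : (p k : Fin 2) → e (opposite p) (opposite k) ≡ e p k
swap-e 0F 0F = refl
swap-e 0F 1F = refl
swap-e 1F 0F = refl
swap-e 1F 1F = refl

opposite-injective : {p q : Fin n} → opposite p ≡ opposite q → p ≡ q
opposite-injective {p = p} {q} eq =
  trans (sym (opposite-involutive p)) (trans (cong opposite eq) (opposite-involutive q))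

module _ (M : BoolMatrix n n) (A : BoolMatrix n 2) (B : BoolMatrix 2 n) (M≈AB : M ≈ A · B) where

  open Factored M A B M≈AB

  disjoint-rows⇒structure : NonzeroRows M → ∀ {i j} → (∀ l → M i l ≡ true → ¬ M j l ≡ true) →
                            AllUnitRows A × NonzeroRows B × DisjointRows B
  disjoint-rows⇒structure nonzero {i} {j} apart with nonzero i | nonzero j
  ... | l , Mil | l′ , Mjl′ with factor⁻ Mil | factor⁻ Mjl′
  ...   | p , Aip , Bpl | q , Ajq , Bql′ with ≡-or-opposite p q
  -- Were the indices equal, `l` would lie in both rows; hence they exhaust `Fin 2`.
  ...     | inj₁ refl = ⊥-elim (apart l Mil (factor⁺ p Ajq Bpl))
  ...     | inj₂ refl = units , nonzeroB , disjoint
    where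
    Ai≗ : A i ≗ e p
    -- A second true entry in `A i` would put `l′`, already in row `j` of `M`, into row `i` as well.
    Ai≗ = unit-vector p Aip (λ Aiq → apart l′ (factor⁺ (opposite p) Aiq Bql′) Mjl′)
    ¬Ajp : ¬ A j p ≡ true
    ¬Ajp Ajp = apart l Mil (factor⁺ p Ajp Bpl)
    Aj≗ : A j ≗ e (opposite p)
    Aj≗ = unit-vector (opposite p) Ajq (subst (λ r → ¬ A j r ≡ true) (sym (opposite-involutive p)) ¬Ajp)
    units : AllUnitRows A
    units r with ≡-or-opposite p r
    ... | inj₁ refl = i , Ai≗
    ... | inj₂ refl = j , Aj≗
    nonzeroB : NonzeroRows B
    nonzeroB r with ≡-or-opposite p r
    ... | inj₁ refl = l , Bpl
    ... | inj₂ refl = l′ , Bql′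
    clash : ∀ x → B p x ≡ true → ¬ B (opposite p) x ≡ true
    clash x Bpx Bqx = apart x (factor⁺ p Aip Bpx) (factor⁺ (opposite p) Ajq Bqx)
    disjoint : DisjointRows B
    disjoint r s x Brx Bsx with ≡-or-opposite p r | ≡-or-opposite p s
    ... | inj₁ refl | inj₁ refl = refl
    ... | inj₁ refl | inj₂ refl = ⊥-elim (clash x Brx Bsx)
    ... | inj₂ refl | inj₁ refl = ⊥-elim (clash x Bsx Brx)
    ... | inj₂ refl | inj₂ refl = refl

-- The 2 × 2 core and the exchange of its indices

module _ (C : BoolMatrix 2 2) where

  -- A walk from `p` to the other vertex must at some point use the edge between them in that
  -- direction.
  power-offdiagonal : ∀ k p → (C ^ k) p (opposite p) ≡ true → C p (opposite p) ≡ true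
  power-offdiagonal zero    0F ()
  power-offdiagonal zero    1F ()
  power-offdiagonal (suc k) p eq with ·-true⁻ C (C ^ k) {j = opposite p} eq
  ... | r , Cpr , rest with ≡-or-opposite p r
  ...   | inj₁ refl = power-offdiagonal k p rest
  ...   | inj₂ refl = Cpr

  -- With a zero diagonal, the powers of C move by parity, so no row of a power is full.
  zero-diagonal : (∀ p → ¬ C p p ≡ true) → ∀ k p → ¬ (∀ q → (C ^ k) p q ≡ true)
  zero-diagonal loopless zero    0F full with () ← full 1F
  zero-diagonal loopless zero    1F full with () ← full 0F
  zero-diagonal loopless (suc k) p  full = zero-diagonal loopless k (opposite p) step
    where
    step : ∀ q → (C ^ k) (opposite p) q ≡ true
    step q with ·-true⁻ C (C ^ k) {j = q} (full q)
    ... | r , Cpr , rest with ≡-or-opposite p r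
    ...   | inj₁ refl = ⊥-elim (loopless p Cpr)
    ...   | inj₂ refl = rest

  primitive⇒loop : ∀ k → C ^ k ≈ J 2 → ∃[ p ] C p p ≡ true
  primitive⇒loop k C^k≈J with any? (λ p → C p p ≟ᵇ true)
  ... | yes loop = loop
  ... | no ¬loop = ⊥-elim (zero-diagonal (λ p Cpp → ¬loop (p , Cpp)) k 0F (C^k≈J 0F))

  W₂-or-J₂ : C 0F 0F ≡ true → (∀ p → C p (opposite p) ≡ true) → C ≈ W₂ ⊎ C ≈ J 2
  W₂-or-J₂ loop off with C 1F 1F in corner
  ... | false = inj₁ λ { 0F 0F → loop ; 0F 1F → off 0F ; 1F 0F → off 1F ; 1F 1F → corner }
  ... | true  = inj₂ λ { 0F 0F → loop ; 0F 1F → off 0F ; 1F 0F → off 1F ; 1F 1F → corner }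

-- Used together with `swapRows`: the product AB is kept, while BA has its two indices exchanged.
swapColumns : BoolMatrix m 2 → BoolMatrix m 2
swapColumns A i k = A i (opposite k)

swapRows : BoolMatrix 2 n → BoolMatrix 2 n
swapRows B k = B (opposite k)

swap-factors : (A : BoolMatrix m 2) (B : BoolMatrix 2 n) → A · B ≈ swapColumns A · swapRows B
swap-factors A B i j
  -- A sum over `Fin 2` unfolds to `x ∨ (y ∨ false)`; regrouping isolates `x ∨ y`, which then
  -- commutes.
  rewrite sym (∨-assoc (A i 0F ∧ B 0F j) (A i 1F ∧ B 1F j) false)
        | ∨-comm (A i 0F ∧ B 0F j) (A i 1F ∧ B 1F j)
  = ∨-assoc (A i 1F ∧ B 1F j) (A i 0F ∧ B 0F j) false

first-column-full : {C : BoolMatrix 2 2} → C ≈ W₂ ⊎ C ≈ J 2 → ∀ p → C p 0F ≡ true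
first-column-full (inj₁ C≈W) 0F = C≈W 0F 0F
first-column-full (inj₁ C≈W) 1F = C≈W 1F 0F
first-column-full (inj₂ C≈J) p  = C≈J p 0F

theorem2p8 : ∀ (n : ℕ) (M : BoolMatrix n n) → Primitive M → IsBooleanRank M 2 →
    IsScramblingIndex M 2 ⇔
    (∃ λ (A : BoolMatrix n 2) → ∃ λ (B : BoolMatrix 2 n) →
    IsBooleanRankFactorization M A B
    × (B · A ≈ W₂ ⊎ B · A ≈ J 2)
    × ((∃[ i ] A i ≗ e 0F) × (∃[ i ] A i ≗ e 1F))
    × (¬ (∃[ j ] column B j ≗ (e 0F ⊕ e 1F))))
theorem2p8 n M prim@(suc k , s≤s _ , M^k≈J) rank = mk⇔ factorize scrambling
  where
  Good : BoolMatrix n 2 → BoolMatrix 2 n → Set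
  Good A B =
    IsBooleanRankFactorization M A B
    × (B · A ≈ W₂ ⊎ B · A ≈ J 2)
    × ((∃[ i ] A i ≗ e 0F) × (∃[ i ] A i ≗ e 1F))
    × (¬ (∃[ j ] column B j ≗ (e 0F ⊕ e 1F)))

  nonzero : NonzeroRows M
  nonzero = primitive⇒nonzeroRows M prim

  good : ∀ {A B} → M ≈ A · B → AllUnitRows A → DisjointRows B →
         (B · A) 0F 0F ≡ true → (∀ p → (B · A) p (opposite p) ≡ true) → Good A B
  good {A} {B} M≈AB units disjoint loop off =
    (rank , M≈AB) , W₂-or-J₂ (B · A) loop off , (units 0F , units 1F) ,
    -- The vector `e 0F ⊕ e 1F` is true in both places, so such a column would force `0F ≡ 1F`.
    λ (j , col) → 0≢1+n (disjoint 0F 1F j (col 0F) (col 1F))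

  factorize : IsScramblingIndex M 2 → ∃ λ A → ∃ λ B → Good A B
  factorize (_ , least)
    with A , B , M≈AB ← proj₁ rank
       -- If all rows of `M ^ 1` met, minimality of 2 would give `2 ≤ 1`.
       | i , j , apart ← disjoint-rows-exist M (λ meet → 1+n≰n (least 1 (s≤s z≤n , meet)))
    with units , nonzeroB , disjoint ← disjoint-rows⇒structure M A B M≈AB nonzero apart
    with C^k≈J ← Factored.core-power M A B M≈AB units nonzeroB disjoint k M^k≈J
    with off ← (λ p → power-offdiagonal (B · A) k p (C^k≈J p (opposite p)))
       | primitive⇒loop (B · A) k C^k≈J
  ... | 0F , loop = A , B , good M≈AB units disjoint loop off
  -- The exchange moves the loop to `0F`: the new corner entry reduces to `(B · A) 1F 1F`, so `loop`
  -- is reused as it is.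
  ... | 1F , loop = swapColumns A , swapRows B ,
    good (λ i j → trans (M≈AB i j) (swap-factors A B i j))
         (λ p → proj₁ (units (opposite p)) ,
                λ k → trans (proj₂ (units (opposite p)) (opposite k)) (swap-e p k))
         (λ p q j Bp Bq → opposite-injective (disjoint (opposite p) (opposite q) j Bp Bq))
         loop (λ p → off (opposite p))

  scrambling : (∃ λ A → ∃ λ B → Good A B) → IsScramblingIndex M 2
  scrambling (A , B , (_ , M≈AB) , core , ((_ , Ai) , (_ , Aj)) , noFull) =
    (s≤s z≤n , square-meets 0F nonzero (first-column-full core)) , least
    where
    open Factored M A B M≈AB

    least : ∀ l → 1 ≤ l × RowsIntersect (M ^ l) → 2 ≤ l
    least zero          (() , _)
    -- A position `l` common to both rows of `B` would make column `l` equal to the excluded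
    -- `e 0F ⊕ e 1F`.
    least (suc zero)    (_ , meet) = ⊥-elim
      (unit-rows-disjoint Ai Aj (λ l p q → noFull (l , λ { 0F → p ; 1F → q })) meet)
    least (suc (suc l)) _ = s≤s (s≤s z≤n)
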